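{- For $\alpha>1$, the runtime of LOHification of rank $\alpha$ by selecting away the layer with the greatest index is in $\Theta\left(\frac{\alpha\cdot n}{\alpha-1}\right)$.
   Context: Layer-ordered heap (LOH) of rank $\alpha\ge 1$ on $n$ elements: a partition of an array of $n$ mutually comparable (distinct) values into consecutive layers $L_0\le L_1\le\cdots\le L_{\ell-1}$ (every element of $L_i$ is $\le$ every element of $L_{i+1}$), each layer being internally unordered. With pivots $p_i=\left\lceil\sum_{j=0}^{i}\alpha^j\right\rceil$, the layer sizes are $|L_0|=p_0=1$, $|L_i|=p_i-p_{i-1}$, and the last layer contains the remaining elements beyond the last pivot that is at most $n$. LOHification of rank $\alpha$ is the problem of rearranging an arbitrary array of length $n$ into a LOH of rank $\alpha$. Selecting away the layer with the greatest index (iterative selection): repeatedly perform a linear-time one-dimensional selection of the value that would be at the first index of $L_{\ell-1}$ were the array sorted, and partition the array about this value; then repeat on the remaining elements for $L_{\ell-2}$, $L_{\ell-3}$, and so on, until the array has been partitioned about the minimum value in each layer. Selection and partition on $m$ remaining elements costs $\Theta(m)$, so the runtime is $\Theta\left(\sum_{i=0}^{\ell-1}\left(n-\sum_{j=\ell-i}^{\ell-1}|L_j|\right)\right)$. Asymptotics are as $n\to\infty$. -}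

module Defs where

open import Algebra.Apartness.Bundles using (HeytingCommutativeRing; HeytingField)
import Algebra.Definitions.RawSemiring as RawSemiringDefs
open import Algebra.Bundles using (CommutativeRing; Semiring; RawSemiring)
open import Data.Fin.Base using (toℕ)
open import Data.List.Base using (List; []; _∷ʳ_; _++_; length)
open import Data.List.Membership.Propositional using (_∈_)
open import Data.List.Relation.Binary.Permutation.Propositional using (_↭_; ↭⇒↭ₛ)
open import Data.List.Relation.Binary.Permutation.Setoid.Properties using (Unique-resp-↭)
open import Data.List.Relation.Unary.All using (All)
open import Data.List.Relation.Unary.All.Properties using (++⁻ˡ)
open import Data.List.Relation.Unary.AllPairs using ([]; _∷_)
open import Data.List.Relation.Unary.Unique.Propositional using (Unique)
open import Data.Nat.Base as ℕ using (ℕ; zero; suc)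
open import Data.Nat.Properties using (_<?_)
open import Data.Product.Base using (∃-syntax; _×_; _,_; proj₁; proj₂)
open import Data.Sum.Base using (_⊎_)
open import Level using (Level; _⊔_) renaming (suc to lsuc)
open import Relation.Binary.Core using (Rel)
open import Relation.Binary.PropositionalEquality using (_≡_; setoid)
open import Relation.Binary.Structures using (IsStrictPartialOrder; IsStrictTotalOrder)
open import Relation.Nullary using (¬_; yes; no)

-- The rank α and all asymptotic constants live in an arbitrary Archimedean
-- ordered field.  The axioms hold for ℚ, for the classical reals and for the
-- constructive (Cauchy or Dedekind) reals; in particular neither
-- decidability of the order nor a computable ceiling function is assumed.

record ArchimedeanOrderedField c ℓ₁ ℓ₂ ℓ₃ : Set (lsuc (c ⊔ ℓ₁ ⊔ ℓ₂ ⊔ ℓ₃)) where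
  field
    heytingField : HeytingField c ℓ₁ ℓ₂

  open HeytingField heytingField public
    using (Carrier; _≈_; _#_; _+_; _*_; _-_; 0#; 1#; #⇒invertible)

  rawSemiring : RawSemiring c ℓ₁
  rawSemiring = Semiring.rawSemiring (CommutativeRing.semiring
    (HeytingCommutativeRing.commutativeRing
      (HeytingField.heytingCommutativeRing heytingField)))

  open RawSemiringDefs rawSemiring public
    using (_^_; sum) renaming (_×_ to _·_)

  infix 4 _<_ _≤_

  field
    _<_                  : Rel Carrier ℓ₃
    isStrictPartialOrder : IsStrictPartialOrder _≈_ _<_
    #⇒<⊎>                : ∀ {x y} → x # y → x < y ⊎ y < x
    >⇒#                  : ∀ {x y} → y < x → x # y
    +-monoˡ-<            : ∀ z {x y} → x < y → x + z < y + z
    *-pos                : ∀ {x y} → 0# < x → 0# < y → 0# < x * y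
    archimedean          : ∀ x → ∃[ n ] x < n · 1#

  _≤_ : Rel Carrier ℓ₃
  x ≤ y = ¬ (y < x)

  fromℕ : ℕ → Carrier
  fromℕ n = n · 1#

  infixl 7 _/⟨_-_⟩_

  -- x /⟨ y - z ⟩ z<y  is  x / (y - z).
  _/⟨_-_⟩_ : Carrier → (y z : Carrier) → z < y → Carrier
  x /⟨ y - z ⟩ z<y = x * proj₁ (#⇒invertible (>⇒# z<y))

module _ {c ℓ₁ ℓ₂ ℓ₃} (R : ArchimedeanOrderedField c ℓ₁ ℓ₂ ℓ₃) where
  open ArchimedeanOrderedField R

  IsCeiling : Carrier → ℕ → Set ℓ₃
  IsCeiling x m = x ≤ fromℕ m × fromℕ m < x + 1#

  IsPivots : Carrier → (ℕ → ℕ) → Set ℓ₃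
  IsPivots α p = ∀ i → IsCeiling (sum {suc i} (λ j → α ^ toℕ j)) (p i)

  -- The costs of a family of inputs, measured against their sizes, lie
  -- eventually between c₁ g and c₂ g.  The threshold depends on the size only,
  -- so this holds for best-case as well as worst-case cost.
  EventuallyBetween : ∀ {i} {I : Set i} (size cost : I → ℕ)
                      (c₁ c₂ : Carrier) (g : ℕ → Carrier) → Set (i ⊔ ℓ₃)
  EventuallyBetween size cost c₁ c₂ g =
    ∃[ N ] ∀ x → N ℕ.≤ size x →
      c₁ * g (size x) ≤ fromℕ (cost x) × fromℕ (cost x) ≤ c₂ * g (size x)

-- First index of layer i, given the pivots p: |L₀| + ⋯ + |Lᵢ₋₁| = pᵢ₋₁.
layerStart : (ℕ → ℕ) → ℕ → ℕ
layerStart p zero    = 0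
layerStart p (suc i) = p i

record Array {a} (A : Set a) : Set a where
  constructor array
  field
    elements : List A
    distinct : Unique elements

  size : ℕ
  size = length elements

module _ {a r} {A : Set a} {_≺_ : Rel A r} (≺-sto : IsStrictTotalOrder _≡_ _≺_) where

  open Array

  private
    Unique-++⁻ˡ : ∀ (xs : List A) {ys} → Unique (xs ++ ys) → Unique xs
    Unique-++⁻ˡ []            _        = []
    Unique-++⁻ˡ (x List.∷ xs) (px ∷ u) = ++⁻ˡ xs px ∷ Unique-++⁻ˡ xs u

  -- Outcome of selecting the value that has index k in the sorted array and
  -- partitioning about it; steps is the cost of doing both.
  record SelectPartition (xs : Array A) (k : ℕ) : Set (a ⊔ r) where
    field
      value       : A
      below rest  : List A
      rearranged  : elements xs ↭ below ++ rest
      below≺value : All (_≺ value) below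
      value∈rest  : value ∈ rest
      value≼rest  : All (λ x → ¬ (x ≺ value)) rest
      index       : length below ≡ k
      steps       : ℕ

    belowArray : Array A
    belowArray = array below
      (Unique-++⁻ˡ below
        (Unique-resp-↭ (setoid A) (↭⇒↭ₛ rearranged) (distinct xs)))

  Selector : Set (a ⊔ r)
  Selector = ∀ xs k → k ℕ.< size xs → SelectPartition xs k

  record SelectionInput : Set a where
    constructor input
    field
      xs  : Array A
      k   : ℕ
      k<n : k ℕ.< size xs

  inputSize : SelectionInput → ℕ
  inputSize (input xs _ _) = size xs

  selectionCost : Selector → SelectionInput → ℕ
  selectionCost select (input xs k k<n) = SelectPartition.steps (select xs k k<n)

  -- Cost Θ(m) on m elements.  A Θ-bound says nothing about small inputs, of
  -- which there may be infinitely many; that the worst-case cost at each size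
  -- is finite is therefore a separate conjunct.
  LinearTime : ∀ {c ℓ₁ ℓ₂ ℓ₃} → ArchimedeanOrderedField c ℓ₁ ℓ₂ ℓ₃ →
               Selector → Set (a ⊔ c ⊔ ℓ₃)
  LinearTime R select =
    (∃[ c₁ ] ∃[ c₂ ] 0# < c₁ × 0# < c₂ ×
      EventuallyBetween R inputSize (selectionCost select) c₁ c₂ fromℕ) ×
    (∀ m → ∃[ B ] ∀ x → inputSize x ≡ m → selectionCost select x ℕ.≤ B)
    where open ArchimedeanOrderedField R

  module _ (select : Selector) (p : ℕ → ℕ) where

    -- Selects away layers i-1, …, 0; returns the layers (least first) and the
    -- total cost.  If layer i would start past the end of the array then the
    -- array has no layer i, and nothing is done for it.
    selectAway : ℕ → Array A → List (List A) × ℕ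
    selectAway zero    xs = [] , 0
    selectAway (suc i) xs with layerStart p i <? size xs
    ... | no  _   = selectAway i xs
    ... | yes k<n = proj₁ lower ∷ʳ rest , steps ℕ.+ proj₂ lower
      where
      open SelectPartition (select xs (layerStart p i) k<n)
      lower = selectAway i belowArray

    -- Pivots of rank α ≥ 1 satisfy layerStart p i ≥ i, so every layer of an
    -- array of size n has index less than n.
    lohify : Array A → List (List A) × ℕ
    lohify xs = selectAway (size xs) xs

    runtime : Array A → ℕ
    runtime xs = proj₂ (lohify xs)

{-# OPTIONS --safe #-}

-- Put δ = α - 1 and G i = 1 + α + ⋯ + αⁱ⁻¹, so that layer i starts at ⌈G i⌉.
-- Selecting away the layers of an array of size n costs, up to constant factors,
-- the volume V = n + p 0 + ⋯ + p (i-1), where i is the index of its last layer,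
-- i.e. ⌈G i⌉ < n ≤ p i.  As δ G (j+1) = α G (j+1) - α G j - 1, the quantity
-- δ (p 0 + ⋯ + p (i-1)) lies between α G i - i and α G i + δ i.  With G i ≤ n this
-- gives δ V ≤ 3 α n; with n < α G i + 2 it gives α n ≤ δ V + i + 2, and i + 2 ≤ n / 2
-- eventually because G grows faster than linearly.  Arrays below the threshold of
-- the linear-time bound occur at most once per size, so they contribute a constant.

module Submission where

open import Defs
open import Algebra.Apartness.Bundles using (HeytingField; HeytingCommutativeRing)
open import Algebra.Bundles using (CommutativeRing)
import Algebra.Apartness.Properties.HeytingCommutativeRing as HeytingProperties
import Algebra.Properties.Ring as RingProperties
import Algebra.Properties.Semiring.Mult as SemiringMult
import Algebra.Properties.Semiring.Sum as SemiringSum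
import Algebra.Solver.Ring.NaturalCoefficients.Default as SemiringSolver
open import Data.Empty using (⊥-elim)
open import Data.Fin.Base using (toℕ)
open import Data.Nat.Base as ℕ using (ℕ; zero; suc; z≤n; s≤s)
import Data.Nat.Properties as ℕₚ
open import Data.Nat.Solver using (module +-*-Solver)
open import Data.Product.Base using (∃-syntax; _×_; _,_; proj₁; proj₂)
open import Data.Sum.Base using (_⊎_; inj₁; inj₂)
open import Relation.Binary.Core using (Rel)
open import Relation.Binary.PropositionalEquality as ≡ using (_≡_)
import Relation.Binary.Reasoning.Base.Triple as Triple
open import Relation.Binary.Structures using (IsPreorder; IsStrictPartialOrder; IsStrictTotalOrder)
open import Relation.Nullary using (yes; no; contradiction)

-- Partial sums of natural sequences, used both for pivots and for slack.

∑< : (ℕ → ℕ) → ℕ → ℕ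
∑< f zero    = 0
∑< f (suc i) = f i ℕ.+ ∑< f i

∑<-mono : ∀ f {m n} → m ℕ.≤ n → ∑< f m ℕ.≤ ∑< f n
∑<-mono f {n = n}     z≤n       = z≤n
∑<-mono f {m} {suc n} m≤1+n with ℕₚ.m≤n⇒m<n∨m≡n m≤1+n
... | inj₁ (s≤s m≤n) = ℕₚ.≤-trans (∑<-mono f m≤n) (ℕₚ.m≤n+m _ (f n))
... | inj₂ ≡.refl    = ℕₚ.≤-refl

-- Terms from `N` on contribute nothing. This makes the total slack a constant, however large the
-- array is.
∑<-bounded : ∀ f N → (∀ m → N ℕ.≤ m → f m ≡ 0) → ∀ n → ∑< f n ℕ.≤ ∑< f N
∑<-bounded f N f≡0 zero = z≤n
∑<-bounded f N f≡0 (suc n) with N ℕₚ.≤? n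
... | yes N≤n rewrite f≡0 n N≤n = ∑<-bounded f N f≡0 n
... | no  N≰n = ∑<-mono f (ℕₚ.≰⇒> N≰n)

truncate : ℕ → (ℕ → ℕ) → ℕ → ℕ
truncate N f m with m ℕₚ.<? N
... | yes _ = f m
... | no  _ = 0

truncate-≥ : ∀ N f m → N ℕ.≤ m → truncate N f m ≡ 0
truncate-≥ N f m N≤m with m ℕₚ.<? N
... | yes m<N = contradiction N≤m (ℕₚ.<⇒≱ m<N)
... | no  _   = ≡.refl

truncate-< : ∀ N f m → m ℕ.< N → truncate N f m ≡ f m
truncate-< N f m m<N with m ℕₚ.<? N
... | yes _   = ≡.refl
... | no  m≮N = contradiction m<N m≮N

-- Order and arithmetic of the field, without deciding the order.

module OrderedField {c ℓ₁ ℓ₂ ℓ₃} (R : ArchimedeanOrderedField c ℓ₁ ℓ₂ ℓ₃) where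
  open ArchimedeanOrderedField R public
  open HeytingField heytingField public using (heytingCommutativeRing; -_; #-cotrans)
  open HeytingProperties heytingCommutativeRing using (1#0; invertibleˡ⇒#; x-0≈x)
  open CommutativeRing (HeytingCommutativeRing.commutativeRing heytingCommutativeRing) public
    using ( refl; sym; trans; +-cong; +-congˡ; +-congʳ; +-assoc; +-comm; +-identityˡ; +-identityʳ
          ; -‿cong; -‿inverseʳ; *-congˡ; *-congʳ; *-assoc
          ; *-identityˡ; zeroʳ; distribˡ; isEquivalence
          ; ring; semiring; commutativeSemiring)
  open RingProperties ring
    using (-‿distribˡ-*; -‿involutive; x[y-z]≈xy-xz; //-rightDividesˡ; //-rightDividesʳ)
  open SemiringMult semiring using (×-homo-+; ×1-homo-*)
  open SemiringSolver commutativeSemiring public using (solve; _:=_; _:+_; _:*_; con)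
  open IsStrictPartialOrder isStrictPartialOrder public
    using (irrefl; <-resp-≈; <-respˡ-≈; <-respʳ-≈) renaming (trans to <-trans; asym to <-asym)

  -- Constructive substitute for comparing `z` with a given element: `z` is apart from `x` or from
  -- `y`, and elements that are apart are ordered. Mixed transitivity of `_<_` and `_≤_` rests on
  -- it.
  <-cotrans : ∀ {x y} → x < y → ∀ z → (x < z) ⊎ (z < y)
  <-cotrans x<y z with #-cotrans (>⇒# x<y) z
  ... | inj₁ y#z with #⇒<⊎> y#z
  ...   | inj₁ y<z = inj₁ (<-trans x<y y<z)
  ...   | inj₂ z<y = inj₂ z<y
  <-cotrans x<y z | inj₂ z#x with #⇒<⊎> z#x
  ...   | inj₁ z<x = inj₂ (<-trans z<x x<y)
  ...   | inj₂ x<z = inj₁ x<z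

  <⇒≤ : ∀ {x y} → x < y → x ≤ y
  <⇒≤ = <-asym

  <-≤-trans : ∀ {x y z} → x < y → y ≤ z → x < z
  <-≤-trans {z = z} x<y y≤z with <-cotrans x<y z
  ... | inj₁ x<z = x<z
  ... | inj₂ z<y = ⊥-elim (y≤z z<y)

  ≤-<-trans : ∀ {x y z} → x ≤ y → y < z → x < z
  ≤-<-trans {x} x≤y y<z with <-cotrans y<z x
  ... | inj₁ y<x = ⊥-elim (x≤y y<x)
  ... | inj₂ x<z = x<z

  ≤-reflexive : ∀ {x y} → x ≈ y → x ≤ y
  ≤-reflexive x≈y y<x = irrefl (sym x≈y) y<x

  ≤-refl : ∀ {x} → x ≤ x
  ≤-refl = ≤-reflexive refl

  ≤-trans : ∀ {x y z} → x ≤ y → y ≤ z → x ≤ z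
  ≤-trans x≤y y≤z z<x = x≤y (≤-<-trans y≤z z<x)

  ≤-isPreorder : IsPreorder _≈_ _≤_
  ≤-isPreorder = record
    { isEquivalence = isEquivalence
    ; reflexive     = ≤-reflexive
    ; trans         = ≤-trans
    }

  open Triple ≤-isPreorder <-asym <-trans <-resp-≈ <⇒≤ <-≤-trans ≤-<-trans public hiding (start)

  +-monoʳ-< : ∀ z {x y} → x < y → z + x < z + y
  +-monoʳ-< z {x} {y} x<y = <-respˡ-≈ (+-comm x z) (<-respʳ-≈ (+-comm y z) (+-monoˡ-< z x<y))

  +-cancelʳ-< : ∀ z {x y} → x + z < y + z → x < y
  +-cancelʳ-< z {x} {y} lt =
    <-respˡ-≈ (//-rightDividesʳ z x) (<-respʳ-≈ (//-rightDividesʳ z y) (+-monoˡ-< (- z) lt))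

  -- Since `x ≤ y` is the negation of `y < x`, weak monotonicity is the contrapositive of strict
  -- cancellation, and vice versa. Products are treated in the same way below.
  +-monoˡ-≤ : ∀ z {x y} → x ≤ y → x + z ≤ y + z
  +-monoˡ-≤ z x≤y lt = x≤y (+-cancelʳ-< z lt)

  +-monoʳ-≤ : ∀ z {x y} → x ≤ y → z + x ≤ z + y
  +-monoʳ-≤ z {x} {y} x≤y = begin
    z + x  ≈⟨ +-comm z x ⟩
    x + z  ≤⟨ +-monoˡ-≤ z x≤y ⟩
    y + z  ≈⟨ +-comm y z ⟩
    z + y  ∎

  +-mono-≤ : ∀ {x y u v} → x ≤ y → u ≤ v → x + u ≤ y + v
  +-mono-≤ x≤y u≤v = ≤-trans (+-monoˡ-≤ _ x≤y) (+-monoʳ-≤ _ u≤v)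

  +-cancelʳ-≤ : ∀ z {x y} → x + z ≤ y + z → x ≤ y
  +-cancelʳ-≤ z le y<x = le (+-monoˡ-< z y<x)

  0<1 : 0# < 1#
  0<1 with #⇒<⊎> 1#0
  ... | inj₂ 0<1 = 0<1
  -- Were 1 negative, -1 would be positive, and so would its square, which is 1.
  ... | inj₁ 1<0 = <-respʳ-≈ -1*-1≈1 (*-pos 0<-1 0<-1)
    where
    0<-1 : 0# < - 1#
    0<-1 = <-respˡ-≈ (-‿inverseʳ 1#) (<-respʳ-≈ (+-identityˡ (- 1#)) (+-monoˡ-< (- 1#) 1<0))
    -1*-1≈1 : - 1# * - 1# ≈ 1#
    -1*-1≈1 = begin-equality
      - 1# * - 1#    ≈⟨ -‿distribˡ-* 1# (- 1#) ⟨
      - (1# * - 1#)  ≈⟨ -‿cong (*-identityˡ (- 1#)) ⟩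
      - - 1#         ≈⟨ -‿involutive 1# ⟩
      1#             ∎

  x<y⇒0<y-x : ∀ {x y} → x < y → 0# < y - x
  x<y⇒0<y-x {x} {y} x<y = <-respˡ-≈ (-‿inverseʳ x) (+-monoˡ-< (- x) x<y)

  *-monoʳ-< : ∀ {z} → 0# < z → ∀ {x y} → x < y → z * x < z * y
  *-monoʳ-< {z} 0<z {x} {y} x<y = begin-strict
    z * x                ≈⟨ +-identityˡ (z * x) ⟨
    0# + z * x           <⟨ +-monoˡ-< (z * x) (*-pos 0<z (x<y⇒0<y-x x<y)) ⟩
    z * (y - x) + z * x  ≈⟨ distribˡ z (y - x) x ⟨
    z * ((y - x) + x)    ≈⟨ *-congˡ (//-rightDividesˡ x y) ⟩
    z * y                ∎

  -- z y # z x makes z (y - x), hence y - x, invertible, so y # x; and y < x is excluded.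
  *-cancelˡ-< : ∀ {z} → 0# < z → ∀ {x y} → z * x < z * y → x < y
  *-cancelˡ-< {z} 0<z {x} {y} zx<zy with #⇒invertible (>⇒# zx<zy)
  ... | u , u[zy-zx]≈1 , _ with #⇒<⊎> (invertibleˡ⇒# {y} {x} (u * z , uz[y-x]≈1))
    where
    uz[y-x]≈1 : (u * z) * (y - x) ≈ 1#
    uz[y-x]≈1 = begin-equality
      (u * z) * (y - x)    ≈⟨ *-assoc u z (y - x) ⟩
      u * (z * (y - x))    ≈⟨ *-congˡ (x[y-z]≈xy-xz z y x) ⟩
      u * (z * y - z * x)  ≈⟨ u[zy-zx]≈1 ⟩
      1#                   ∎
  ...   | inj₁ y<x = ⊥-elim (<-asym zx<zy (*-monoʳ-< 0<z y<x))
  ...   | inj₂ x<y = x<y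

  *-monoʳ-≤ : ∀ {z} → 0# < z → ∀ {x y} → x ≤ y → z * x ≤ z * y
  *-monoʳ-≤ 0<z x≤y lt = x≤y (*-cancelˡ-< 0<z lt)

  *-cancelˡ-≤ : ∀ {z} → 0# < z → ∀ {x y} → z * x ≤ z * y → x ≤ y
  *-cancelˡ-≤ 0<z le y<x = le (*-monoʳ-< 0<z y<x)

  *-nonneg : ∀ {z} → 0# < z → ∀ {x} → 0# ≤ x → 0# ≤ z * x
  *-nonneg {z} 0<z {x} 0≤x = begin
    0#      ≈⟨ zeroʳ z ⟨
    z * 0#  ≤⟨ *-monoʳ-≤ 0<z 0≤x ⟩
    z * x   ∎

  inverse-pos : ∀ {z w} → 0# < z → z * w ≈ 1# → 0# < w
  inverse-pos {z} {w} 0<z zw≈1 = *-cancelˡ-< 0<z (begin-strict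
    z * 0#  ≈⟨ zeroʳ z ⟩
    0#      <⟨ 0<1 ⟩
    1#      ≈⟨ zw≈1 ⟨
    z * w   ∎)

  recip : ∀ {z} → 0# < z → ∃[ w ] z * w ≈ 1#
  recip {z} 0<z with #⇒invertible (>⇒# 0<z)
  ... | w , _ , [z-0]w≈1 =
    w , trans (*-congʳ (sym (x-0≈x z))) [z-0]w≈1

  fromℕ-+ : ∀ m n → fromℕ (m ℕ.+ n) ≈ fromℕ m + fromℕ n
  fromℕ-+ = ×-homo-+ 1#

  fromℕ-* : ∀ m n → fromℕ (m ℕ.* n) ≈ fromℕ m * fromℕ n
  fromℕ-* = ×1-homo-*

  0≤fromℕ : ∀ n → 0# ≤ fromℕ n
  0≤fromℕ zero    = ≤-refl
  0≤fromℕ (suc n) = begin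
    0#            ≤⟨ 0≤fromℕ n ⟩
    fromℕ n       ≈⟨ +-identityˡ (fromℕ n) ⟨
    0# + fromℕ n  <⟨ +-monoˡ-< (fromℕ n) 0<1 ⟩
    1# + fromℕ n  ∎

  fromℕ-mono-≤ : ∀ {m n} → m ℕ.≤ n → fromℕ m ≤ fromℕ n
  fromℕ-mono-≤ {n = n} z≤n = 0≤fromℕ n
  fromℕ-mono-≤ (s≤s m≤n)   = +-monoʳ-≤ 1# (fromℕ-mono-≤ m≤n)

  fromℕ-mono-< : ∀ {m n} → m ℕ.< n → fromℕ m < fromℕ n
  fromℕ-mono-< {m} {n} m<n = begin-strict
    fromℕ m       ≈⟨ +-identityˡ (fromℕ m) ⟨
    0# + fromℕ m  <⟨ +-monoˡ-< (fromℕ m) 0<1 ⟩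
    1# + fromℕ m  ≤⟨ fromℕ-mono-≤ m<n ⟩
    fromℕ n       ∎

  -- Brings estimates made in the field back to ℕ. Refuting the opposite inequality is enough,
  -- because the order of ℕ is decidable.
  fromℕ-cancel-< : ∀ {m n} → fromℕ m < fromℕ n → m ℕ.< n
  fromℕ-cancel-< lt = ℕₚ.≰⇒> λ n≤m → fromℕ-mono-≤ n≤m lt

  fromℕ-cancel-≤ : ∀ {m n} → fromℕ m ≤ fromℕ n → m ℕ.≤ n
  fromℕ-cancel-≤ le = ℕₚ.≮⇒≥ λ n<m → le (fromℕ-mono-< n<m)

  0<4 : 0# < fromℕ 4
  0<4 = fromℕ-mono-< {0} {4} (s≤s z≤n)

-- Supplies i + 2 ≤ n / 2 for the lower bound on the volume. The doubled left side is 8 + 4i, at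
-- most n + (8 + 4j), hence at most 2n.
2[2+i]≤n : ∀ {i j n} → 4 ℕ.* i ℕ.≤ n ℕ.+ 4 ℕ.* j → 8 ℕ.+ 4 ℕ.* j ℕ.≤ n → 2 ℕ.* (2 ℕ.+ i) ℕ.≤ n
2[2+i]≤n {i} {j} {n} 4i≤n+4j 8+4j≤n = ℕₚ.*-cancelˡ-≤ 2 (begin
  2 ℕ.* (2 ℕ.* (2 ℕ.+ i))
    ≡⟨ solve 1 (λ i → con 2 :* (con 2 :* (con 2 :+ i)) := con 8 :+ con 4 :* i) ≡.refl i ⟩
  8 ℕ.+ 4 ℕ.* i              ≤⟨ ℕₚ.+-monoʳ-≤ 8 4i≤n+4j ⟩
  8 ℕ.+ (n ℕ.+ 4 ℕ.* j)
    ≡⟨ solve 2 (λ n k → con 8 :+ (n :+ k) := n :+ (con 8 :+ k)) ≡.refl n (4 ℕ.* j) ⟩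
  n ℕ.+ (8 ℕ.+ 4 ℕ.* j)      ≤⟨ ℕₚ.+-monoʳ-≤ n 8+4j≤n ⟩
  n ℕ.+ n                    ≡⟨ ≡.cong (n ℕ.+_) (ℕₚ.+-identityʳ n) ⟨
  2 ℕ.* n                    ∎)
  where
  open ℕₚ.≤-Reasoning
  open +-*-Solver using (solve; con; _:=_; _:+_; _:*_)

module Analysis {c ℓ₁ ℓ₂ ℓ₃} (R : ArchimedeanOrderedField c ℓ₁ ℓ₂ ℓ₃) where
  open OrderedField R

  -- Pivots, geometric sums and the volume.

  module Pivots {α δ : Carrier} (α≈δ+1 : α ≈ δ + 1#) (0<δ : 0# < δ)
    {p : ℕ → ℕ} (isPivots : IsPivots R α p)
    where

    private
      start : ℕ → ℕ
      start = layerStart p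

    1≤α : 1# ≤ α
    1≤α = begin
      1#       ≈⟨ +-identityˡ 1# ⟨
      0# + 1#  <⟨ +-monoˡ-< 1# 0<δ ⟩
      δ + 1#   ≈⟨ α≈δ+1 ⟨
      α        ∎

    0<α : 0# < α
    0<α = <-≤-trans 0<1 1≤α

    -- Working with δ instead of α - 1 keeps the identities free of subtraction, so that the
    -- semiring solver applies to them.
    αx≈δx+x : ∀ x → α * x ≈ δ * x + x
    αx≈δx+x x = begin-equality
      α * x         ≈⟨ *-congʳ α≈δ+1 ⟩
      (δ + 1#) * x  ≈⟨ solve 2 (λ d y → (d :+ con 1) :* y := d :* y :+ y) refl δ x ⟩
      δ * x + x     ∎

    n≤αn : ∀ n → fromℕ n ≤ α * fromℕ n
    n≤αn n = begin
      fromℕ n                ≈⟨ +-identityˡ _ ⟨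
      0# + fromℕ n           ≤⟨ +-monoˡ-≤ _ (*-nonneg 0<δ (0≤fromℕ n)) ⟩
      δ * fromℕ n + fromℕ n  ≈⟨ αx≈δx+x (fromℕ n) ⟨
      α * fromℕ n            ∎

    δn≤αn : ∀ n → δ * fromℕ n ≤ α * fromℕ n
    δn≤αn n = begin
      δ * fromℕ n            ≈⟨ +-identityʳ _ ⟨
      δ * fromℕ n + 0#       ≤⟨ +-monoʳ-≤ _ (0≤fromℕ n) ⟩
      δ * fromℕ n + fromℕ n  ≈⟨ αx≈δx+x (fromℕ n) ⟨
      α * fromℕ n            ∎

    geometric : ℕ → Carrier
    geometric i = sum {i} (λ j → α ^ toℕ j)

    -- Horner's scheme: the term j = 0 is split off and α is factored out of the others.
    geometric-suc : ∀ i → geometric (suc i) ≈ 1# + α * geometric i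
    geometric-suc i = +-congˡ (sym (SemiringSum.*-distribˡ-sum semiring {i} α _))

    -- Extends the hypothesis on pivots to the empty sum, so that layer 0 needs no separate
    -- treatment.
    start-ceiling : ∀ i → IsCeiling R (geometric i) (start i)
    start-ceiling zero    = ≤-refl , <-respʳ-≈ (sym (+-identityˡ 1#)) 0<1
    start-ceiling (suc i) = isPivots i

    geometric-increment : ∀ i → geometric (suc i) ≈ (geometric i + 1#) + δ * geometric i
    geometric-increment i = begin-equality
      geometric (suc i)                     ≈⟨ geometric-suc i ⟩
      1# + α * geometric i                  ≈⟨ +-congˡ (αx≈δx+x (geometric i)) ⟩
      1# + (δ * geometric i + geometric i)
        ≈⟨ solve 2 (λ x g → con 1 :+ (x :+ g) := (g :+ con 1) :+ x) refl _ _ ⟩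
      (geometric i + 1#) + δ * geometric i ∎

    -- A mutual induction: the step from G i adds 1 + δ G i, which is at least 1 once G i is
    -- nonnegative; that follows from i ≤ G i, which in turn comes from the earlier steps.
    fromℕ≤geometric : ∀ i → fromℕ i ≤ geometric i
    0≤geometric : ∀ i → 0# ≤ geometric i
    geometric-step : ∀ i → geometric i + 1# ≤ geometric (suc i)

    fromℕ≤geometric zero    = ≤-refl
    fromℕ≤geometric (suc i) = begin
      1# + fromℕ i       ≈⟨ +-comm 1# (fromℕ i) ⟩
      fromℕ i + 1#       ≤⟨ +-monoˡ-≤ 1# (fromℕ≤geometric i) ⟩
      geometric i + 1#   ≤⟨ geometric-step i ⟩
      geometric (suc i)  ∎

    0≤geometric i = ≤-trans (0≤fromℕ i) (fromℕ≤geometric i)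

    geometric-step i = begin
      geometric i + 1#                      ≈⟨ +-identityʳ _ ⟨
      (geometric i + 1#) + 0#               ≤⟨ +-monoʳ-≤ _ (*-nonneg 0<δ (0≤geometric i)) ⟩
      (geometric i + 1#) + δ * geometric i  ≈⟨ geometric-increment i ⟨
      geometric (suc i)                     ∎

    -- Rounding up adds less than 1, while consecutive geometric sums differ by at least 1.
    start-increasing : ∀ i → start i ℕ.< start (suc i)
    start-increasing i = fromℕ-cancel-< (begin-strict
      fromℕ (start i)        <⟨ proj₂ (start-ceiling i) ⟩
      geometric i + 1#       ≤⟨ geometric-step i ⟩
      geometric (suc i)      ≤⟨ proj₁ (start-ceiling (suc i)) ⟩
      fromℕ (start (suc i))  ∎)

    -- Serves twice: `n` rounds suffice for an array of size `n`, and the index of its last layer is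
    -- at most `n`.
    i≤start : ∀ i → i ℕ.≤ start i
    i≤start i = fromℕ-cancel-≤ (≤-trans (fromℕ≤geometric i) (proj₁ (start-ceiling i)))

    -- The increments 1 + δ G i ≥ 1 + δ i of G are at least 4 from any index J > 3 / δ on.
    geometric-superlinear : ∃[ J ] ∀ i → 4 ℕ.* i ℕ.≤ start i ℕ.+ 4 ℕ.* J
    geometric-superlinear with recip 0<δ
    ... | δ⁻¹ , δδ⁻¹≈1 with archimedean (δ⁻¹ * fromℕ 3)
    ...   | J , 3/δ<J = J , λ i → fromℕ-cancel-≤ (begin
      fromℕ (4 ℕ.* i)                      ≤⟨ bound i ⟩
      geometric i + fromℕ (4 ℕ.* J)        ≤⟨ +-monoˡ-≤ _ (proj₁ (start-ceiling i)) ⟩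
      fromℕ (start i) + fromℕ (4 ℕ.* J)    ≈⟨ fromℕ-+ (start i) (4 ℕ.* J) ⟨
      fromℕ (start i ℕ.+ 4 ℕ.* J)          ∎)
      where
      increment : ∀ i → J ℕ.≤ i → geometric i + fromℕ 4 ≤ geometric (suc i)
      increment i J≤i = begin
        geometric i + (1# + fromℕ 3)          ≈⟨ +-assoc _ _ _ ⟨
        (geometric i + 1#) + fromℕ 3          ≈⟨ +-congˡ (*-identityˡ (fromℕ 3)) ⟨
        (geometric i + 1#) + 1# * fromℕ 3     ≈⟨ +-congˡ (*-congʳ δδ⁻¹≈1) ⟨
        (geometric i + 1#) + (δ * δ⁻¹) * fromℕ 3  ≈⟨ +-congˡ (*-assoc δ δ⁻¹ (fromℕ 3)) ⟩
        (geometric i + 1#) + δ * (δ⁻¹ * fromℕ 3)  <⟨ +-monoʳ-< _ (*-monoʳ-< 0<δ 3/δ<J) ⟩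
        (geometric i + 1#) + δ * fromℕ J      ≤⟨ +-monoʳ-≤ _ (*-monoʳ-≤ 0<δ (fromℕ-mono-≤ J≤i)) ⟩
        (geometric i + 1#) + δ * fromℕ i      ≤⟨ +-monoʳ-≤ _ (*-monoʳ-≤ 0<δ (fromℕ≤geometric i)) ⟩
        (geometric i + 1#) + δ * geometric i  ≈⟨ geometric-increment i ⟨
        geometric (suc i)                     ∎
      -- Up to index `J` the summand 4J pays for everything; afterwards each increment of G pays for
      -- the new 4.
      bound : ∀ i → fromℕ (4 ℕ.* i) ≤ geometric i + fromℕ (4 ℕ.* J)
      bound zero = ≤-trans (0≤fromℕ (4 ℕ.* J)) (≤-reflexive (sym (+-identityˡ _)))
      bound (suc i) with J ℕₚ.≤? i
      ... | yes J≤i = begin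
        fromℕ (4 ℕ.* suc i)                         ≡⟨ ≡.cong fromℕ (ℕₚ.*-suc 4 i) ⟩
        fromℕ (4 ℕ.+ 4 ℕ.* i)                       ≈⟨ fromℕ-+ 4 (4 ℕ.* i) ⟩
        fromℕ 4 + fromℕ (4 ℕ.* i)                   ≤⟨ +-monoʳ-≤ _ (bound i) ⟩
        fromℕ 4 + (geometric i + fromℕ (4 ℕ.* J))   ≈⟨ +-assoc _ _ _ ⟨
        (fromℕ 4 + geometric i) + fromℕ (4 ℕ.* J)   ≈⟨ +-congʳ (+-comm _ _) ⟩
        (geometric i + fromℕ 4) + fromℕ (4 ℕ.* J)   ≤⟨ +-monoˡ-≤ _ (increment i J≤i) ⟩
        geometric (suc i) + fromℕ (4 ℕ.* J)         ∎
      ... | no J≰i = begin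
        fromℕ (4 ℕ.* suc i)                  ≤⟨ fromℕ-mono-≤ (ℕₚ.*-monoʳ-≤ 4 (ℕₚ.≰⇒> J≰i)) ⟩
        fromℕ (4 ℕ.* J)                      ≈⟨ +-identityˡ _ ⟨
        0# + fromℕ (4 ℕ.* J)                 ≤⟨ +-monoˡ-≤ _ (0≤geometric (suc i)) ⟩
        geometric (suc i) + fromℕ (4 ℕ.* J)  ∎

    -- Multiplied by δ, the sum of the geometric sums telescopes:
    -- δ G (i+1) = α G (i+1) - G (i+1) = α G (i+1) - α G i - 1.
    telescope : ∀ i → δ * geometric (suc i) + (α * geometric i + 1#) ≈ α * geometric (suc i)
    telescope i = begin-equality
      δ * geometric (suc i) + (α * geometric i + 1#)  ≈⟨ +-congˡ (+-comm _ _) ⟩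
      δ * geometric (suc i) + (1# + α * geometric i)  ≈⟨ +-congˡ (geometric-suc i) ⟨
      δ * geometric (suc i) + geometric (suc i)       ≈⟨ αx≈δx+x (geometric (suc i)) ⟨
      α * geometric (suc i)                           ∎

    -- Rounding costs at most δ per pivot, which gives δ i on the right. The 1 lost in each step of
    -- the telescoping gives i on the left.
    ∑pivots-upper : ∀ i → δ * fromℕ (∑< p i) + fromℕ i ≤ α * geometric i + δ * fromℕ i
    ∑pivots-upper zero    = ≤-reflexive (begin-equality
      δ * 0# + 0#       ≈⟨ +-comm _ _ ⟩
      0# + δ * 0#       ≈⟨ +-congʳ (zeroʳ α) ⟨
      α * 0# + δ * 0#   ∎)
    ∑pivots-upper (suc i) = begin
      δ * fromℕ (p i ℕ.+ ∑< p i) + (1# + fromℕ i)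
        ≈⟨ +-congʳ (*-congˡ (fromℕ-+ (p i) (∑< p i))) ⟩
      δ * (fromℕ (p i) + fromℕ (∑< p i)) + (1# + fromℕ i)
        ≤⟨ +-monoˡ-≤ _ (*-monoʳ-≤ 0<δ (+-monoˡ-≤ _ (<⇒≤ (proj₂ (isPivots i))))) ⟩
      δ * ((geometric (suc i) + 1#) + fromℕ (∑< p i)) + (1# + fromℕ i)
        ≈⟨ solve 4 (λ d g s k → d :* ((g :+ con 1) :+ s) :+ (con 1 :+ k)
                   := (d :* g :+ d :+ con 1) :+ (d :* s :+ k)) refl δ _ _ _ ⟩
      (δ * geometric (suc i) + δ + 1#) + (δ * fromℕ (∑< p i) + fromℕ i)
        ≤⟨ +-monoʳ-≤ _ (∑pivots-upper i) ⟩
      (δ * geometric (suc i) + δ + 1#) + (α * geometric i + δ * fromℕ i)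
        ≈⟨ solve 4 (λ d g a k → (d :* g :+ d :+ con 1) :+ (a :+ d :* k)
                   := (d :* g :+ (a :+ con 1)) :+ d :* (con 1 :+ k)) refl δ _ _ _ ⟩
      (δ * geometric (suc i) + (α * geometric i + 1#)) + δ * (1# + fromℕ i)
        ≈⟨ +-congʳ (telescope i) ⟩
      α * geometric (suc i) + δ * (1# + fromℕ i) ∎

    -- The same telescoping; here rounding up works in favour of the bound, so only the loss i
    -- remains.
    ∑pivots-lower : ∀ i → α * geometric i ≤ δ * fromℕ (∑< p i) + fromℕ i
    ∑pivots-lower zero    = ≤-reflexive (begin-equality
      α * 0#       ≈⟨ zeroʳ α ⟩
      0#           ≈⟨ zeroʳ δ ⟨
      δ * 0#       ≈⟨ +-identityʳ _ ⟨
      δ * 0# + 0#  ∎)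
    ∑pivots-lower (suc i) = begin
      α * geometric (suc i)
        ≈⟨ telescope i ⟨
      δ * geometric (suc i) + (α * geometric i + 1#)
        ≤⟨ +-mono-≤ (*-monoʳ-≤ 0<δ (proj₁ (isPivots i))) (+-monoˡ-≤ 1# (∑pivots-lower i)) ⟩
      δ * fromℕ (p i) + ((δ * fromℕ (∑< p i) + fromℕ i) + 1#)
        ≈⟨ solve 4 (λ d x s k → d :* x :+ ((d :* s :+ k) :+ con 1)
                   := d :* (x :+ s) :+ (con 1 :+ k)) refl δ _ _ _ ⟩
      δ * (fromℕ (p i) + fromℕ (∑< p i)) + (1# + fromℕ i)
        ≈⟨ +-congʳ (*-congˡ (fromℕ-+ (p i) (∑< p i))) ⟨
      δ * fromℕ (p i ℕ.+ ∑< p i) + (1# + fromℕ i) ∎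

    -- The factor 3 counts δ n, α G i and the rounding term δ i, each at most α n; for the last, i ≤
    -- `start i` ≤ n.
    volume-upper : ∀ {n i} → start i ℕ.≤ n →
                   δ * fromℕ (n ℕ.+ ∑< p i) ≤ fromℕ 3 * (α * fromℕ n)
    volume-upper {n} {i} start≤n = begin
      δ * fromℕ (n ℕ.+ ∑< p i)
        ≈⟨ *-congˡ (fromℕ-+ n (∑< p i)) ⟩
      δ * (fromℕ n + fromℕ (∑< p i))
        ≈⟨ distribˡ δ _ _ ⟩
      δ * fromℕ n + δ * fromℕ (∑< p i)
        ≈⟨ +-congˡ (+-identityʳ _) ⟨
      δ * fromℕ n + (δ * fromℕ (∑< p i) + 0#)
        ≤⟨ +-monoʳ-≤ _ (≤-trans (+-monoʳ-≤ _ (0≤fromℕ i)) (∑pivots-upper i)) ⟩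
      δ * fromℕ n + (α * geometric i + δ * fromℕ i)
        ≤⟨ +-mono-≤ (δn≤αn n) (+-mono-≤
             (*-monoʳ-≤ 0<α (≤-trans (proj₁ (start-ceiling i)) (fromℕ-mono-≤ start≤n)))
             (≤-trans (*-monoʳ-≤ 0<δ (fromℕ-mono-≤ (ℕₚ.≤-trans (i≤start i) start≤n))) (δn≤αn n))) ⟩
      α * fromℕ n + (α * fromℕ n + α * fromℕ n)
        ≈⟨ solve 1 (λ x → x :+ (x :+ x)
                   := (con 1 :+ (con 1 :+ (con 1 :+ con 0))) :* x) refl (α * fromℕ n) ⟩
      fromℕ 3 * (α * fromℕ n) ∎

    -- The estimate `αn≤` is doubled, so that its error 2 (2 + i) is at most n ≤ α n and one of the
    -- two copies of α n can be cancelled against it.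
    volume-lower : ∀ {n i} → n ℕ.≤ p i → 2 ℕ.* (2 ℕ.+ i) ℕ.≤ n →
                   α * fromℕ n ≤ fromℕ 2 * (δ * fromℕ (n ℕ.+ ∑< p i))
    volume-lower {n} {i} n≤pᵢ 2[2+i]≤n = +-cancelʳ-≤ (α * fromℕ n) (begin
      α * fromℕ n + α * fromℕ n
        ≤⟨ +-mono-≤ αn≤ αn≤ ⟩
      (δ * V + fromℕ (2 ℕ.+ i)) + (δ * V + fromℕ (2 ℕ.+ i))
        ≈⟨ solve 2 (λ x y → (x :+ y) :+ (x :+ y) := two :* x :+ two :* y) refl _ _ ⟩
      fromℕ 2 * (δ * V) + fromℕ 2 * fromℕ (2 ℕ.+ i)
        ≈⟨ +-congˡ (fromℕ-* 2 (2 ℕ.+ i)) ⟨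
      fromℕ 2 * (δ * V) + fromℕ (2 ℕ.* (2 ℕ.+ i))
        ≤⟨ +-monoʳ-≤ _ (fromℕ-mono-≤ 2[2+i]≤n) ⟩
      fromℕ 2 * (δ * V) + fromℕ n
        ≤⟨ +-monoʳ-≤ _ (n≤αn n) ⟩
      fromℕ 2 * (δ * V) + α * fromℕ n ∎)
      where
      V = fromℕ (n ℕ.+ ∑< p i)
      two = con 1 :+ (con 1 :+ con 0)
      -- In 2 + i, one unit is the leading term of G (i+1), one is the rounding of `p i`, and i is
      -- the loss in `∑pivots-lower`.
      αn≤ : α * fromℕ n ≤ δ * V + fromℕ (2 ℕ.+ i)
      αn≤ = begin
        α * fromℕ n
          ≈⟨ αx≈δx+x (fromℕ n) ⟩
        δ * fromℕ n + fromℕ n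
          ≤⟨ +-monoʳ-≤ _ (fromℕ-mono-≤ n≤pᵢ) ⟩
        δ * fromℕ n + fromℕ (p i)
          <⟨ +-monoʳ-< _ (proj₂ (isPivots i)) ⟩
        δ * fromℕ n + (geometric (suc i) + 1#)
          ≈⟨ +-congˡ (+-congʳ (geometric-suc i)) ⟩
        δ * fromℕ n + ((1# + α * geometric i) + 1#)
          ≤⟨ +-monoʳ-≤ _ (+-monoˡ-≤ _ (+-monoʳ-≤ _ (∑pivots-lower i))) ⟩
        δ * fromℕ n + ((1# + (δ * fromℕ (∑< p i) + fromℕ i)) + 1#)
          ≈⟨ solve 4 (λ d x s k → d :* x :+ ((con 1 :+ (d :* s :+ k)) :+ con 1)
                     := d :* (x :+ s) :+ (con 1 :+ (con 1 :+ k))) refl δ _ _ _ ⟩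
        δ * (fromℕ n + fromℕ (∑< p i)) + fromℕ (2 ℕ.+ i)
          ≈⟨ +-congʳ (*-congˡ (fromℕ-+ n (∑< p i))) ⟨
        δ * V + fromℕ (2 ℕ.+ i) ∎

  -- Accounting of cost against volume along the iterated selection.

  module Cost {c₁ c₂ : Carrier} (0<c₁ : 0# < c₁) where

    -- The slack absorbs the selections from arrays too small for the Θ-bound to apply.
    record Within (cost volume slack : ℕ) : Set ℓ₃ where
      constructor within
      field
        upper : fromℕ cost ≤ c₂ * fromℕ volume + fromℕ slack
        lower : c₁ * fromℕ volume ≤ fromℕ cost + c₁ * fromℕ slack

    within-0 : Within 0 0 0
    within-0 = within
      (≤-reflexive (sym (trans (+-identityʳ _) (zeroʳ c₂))))
      (≤-reflexive (sym (+-identityˡ _)))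

    within-+ : ∀ {t v w t′ v′ w′} → Within t v w → Within t′ v′ w′ →
               Within (t ℕ.+ t′) (v ℕ.+ v′) (w ℕ.+ w′)
    within-+ {t} {v} {w} {t′} {v′} {w′} (within u l) (within u′ l′) = within upper lower
      where
      upper = begin
        fromℕ (t ℕ.+ t′)                                           ≈⟨ fromℕ-+ t t′ ⟩
        fromℕ t + fromℕ t′                                         ≤⟨ +-mono-≤ u u′ ⟩
        (c₂ * fromℕ v + fromℕ w) + (c₂ * fromℕ v′ + fromℕ w′)
          ≈⟨ solve 5 (λ k a b d e → (k :* a :+ b) :+ (k :* d :+ e)
                     := k :* (a :+ d) :+ (b :+ e)) refl c₂ _ _ _ _ ⟩
        c₂ * (fromℕ v + fromℕ v′) + (fromℕ w + fromℕ w′)           ≈⟨ +-cong (*-congˡ (fromℕ-+ v v′)) (fromℕ-+ w w′) ⟨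
        c₂ * fromℕ (v ℕ.+ v′) + fromℕ (w ℕ.+ w′)                   ∎
      lower = begin
        c₁ * fromℕ (v ℕ.+ v′)                                      ≈⟨ *-congˡ (fromℕ-+ v v′) ⟩
        c₁ * (fromℕ v + fromℕ v′)                                  ≈⟨ distribˡ c₁ _ _ ⟩
        c₁ * fromℕ v + c₁ * fromℕ v′                               ≤⟨ +-mono-≤ l l′ ⟩
        (fromℕ t + c₁ * fromℕ w) + (fromℕ t′ + c₁ * fromℕ w′)
          ≈⟨ solve 5 (λ k a b d e → (a :+ k :* b) :+ (d :+ k :* e)
                     := (a :+ d) :+ k :* (b :+ e)) refl c₁ _ _ _ _ ⟩
        (fromℕ t + fromℕ t′) + c₁ * (fromℕ w + fromℕ w′)           ≈⟨ +-cong (fromℕ-+ t t′) (*-congˡ (fromℕ-+ w w′)) ⟨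
        fromℕ (t ℕ.+ t′) + c₁ * fromℕ (w ℕ.+ w′)                   ∎

    within-mono : ∀ {t v w w′} → w ℕ.≤ w′ → Within t v w → Within t v w′
    within-mono w≤w′ (within u l) = within
      (≤-trans u (+-monoʳ-≤ _ (fromℕ-mono-≤ w≤w′)))
      (≤-trans l (+-monoʳ-≤ _ (*-monoʳ-≤ 0<c₁ (fromℕ-mono-≤ w≤w′))))

    module _ {a r} {A : Set a} {_≺_ : Rel A r} (≺-sto : IsStrictTotalOrder _≡_ _≺_)
      (select : Selector ≺-sto) (p : ℕ → ℕ)
      (increasing : ∀ i → layerStart p i ℕ.< layerStart p (suc i))
      (slack : ℕ → ℕ)
      (selection : ∀ x →
        Within (selectionCost ≺-sto select x) (inputSize ≺-sto x) (slack (inputSize ≺-sto x)))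
      where

      private
        start : ℕ → ℕ
        start = layerStart p

        cost : ℕ → Array A → ℕ
        cost i xs = proj₂ (selectAway ≺-sto select p i xs)

      -- Below a selected layer the remaining size is exactly the start of that layer, so every
      -- further layer is present. These sizes strictly decrease, so slack is charged at most once
      -- per size and its partial sum covers all charges.
      selectAway-aligned : ∀ i xs → Array.size xs ≡ start i →
                           Within (cost i xs) (∑< p i) (∑< slack (suc (start i)))
      selectAway-aligned zero    xs _ = within-mono z≤n within-0
      selectAway-aligned (suc i) xs size≡pᵢ with start i ℕₚ.<? Array.size xs
      ... | no  s≮n = contradiction (≡.subst (start i ℕ.<_) (≡.sym size≡pᵢ) (increasing i)) s≮n
      ... | yes s<n = within-mono
        (ℕₚ.+-monoʳ-≤ (slack (p i)) (∑<-mono slack (increasing i)))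
        (within-+
          (≡.subst (λ m → Within steps m (slack m)) size≡pᵢ (selection (input xs (start i) s<n)))
          (selectAway-aligned i belowArray index))
        where open SelectPartition (select xs (start i) s<n)

      -- Rounds for absent layers are free, and each failed comparison tightens the upper bound on
      -- `n`. The first layer found is the last layer `j` of the array; its selection contributes
      -- `n` to the volume and leaves an aligned array. An empty array has no such `j`.
      selectAway-within : ∀ i xs → let n = Array.size xs in 0 ℕ.< n → n ℕ.≤ start i →
        ∃[ j ] start j ℕ.< n × n ℕ.≤ p j ×
          Within (cost i xs) (n ℕ.+ ∑< p j) (∑< slack (suc n))
      selectAway-within zero    xs 0<n n≤0 = contradiction n≤0 (ℕₚ.<⇒≱ 0<n)
      selectAway-within (suc i) xs 0<n n≤pᵢ with start i ℕₚ.<? Array.size xs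
      ... | no  s≮n = selectAway-within i xs 0<n (ℕₚ.≮⇒≥ s≮n)
      ... | yes s<n = i , s<n , n≤pᵢ , within-mono
        (ℕₚ.+-monoʳ-≤ (slack (Array.size xs)) (∑<-mono slack s<n))
        (within-+
          (selection (input xs (start i) s<n))
          (selectAway-aligned i belowArray index))
        where open SelectPartition (select xs (start i) s<n)

  -- Comparison of the cost with α n / (α - 1), and the choice of constants.

  module Conclusion
    {α δ δ⁻¹ : Carrier} (α≈δ+1 : α ≈ δ + 1#) (0<δ : 0# < δ) (δδ⁻¹≈1 : δ * δ⁻¹ ≈ 1#)
    {p : ℕ → ℕ} (isPivots : IsPivots R α p)
    {c₁ c₂ : Carrier} (0<c₁ : 0# < c₁) (0<c₂ : 0# < c₂)
    (n i : ℕ) {t w : ℕ} (withinBounds : Cost.Within {c₁} {c₂} 0<c₁ t (n ℕ.+ ∑< p i) w)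
    (4w≤n : 4 ℕ.* w ℕ.≤ n)
    where

    open Pivots α≈δ+1 0<δ {p} isPivots
    open Cost {c₁} {c₂} 0<c₁
    open Within withinBounds

    private
      T = fromℕ t
      V = fromℕ (n ℕ.+ ∑< p i)
      W = fromℕ w
      Y = α * fromℕ n

    -- Clears the denominator, so that both bounds can be proved after multiplication by δ.
    δ[kYδ⁻¹]≈kY : ∀ k → δ * (k * (Y * δ⁻¹)) ≈ k * Y
    δ[kYδ⁻¹]≈kY k = begin-equality
      δ * (k * (Y * δ⁻¹))
        ≈⟨ solve 4 (λ d e k y → d :* (k :* (y :* e)) := (d :* e) :* (k :* y)) refl δ δ⁻¹ k Y ⟩
      (δ * δ⁻¹) * (k * Y)  ≈⟨ *-congʳ δδ⁻¹≈1 ⟩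
      1# * (k * Y)         ≈⟨ *-identityˡ _ ⟩
      k * Y                ∎

    -- The part 3 c₂ comes from the volume; the additional 1 pays for the slack, since δ w ≤ δ n ≤ α
    -- n.
    cost-upper : layerStart p i ℕ.≤ n → T ≤ (fromℕ 3 * c₂ + 1#) * (Y * δ⁻¹)
    cost-upper start≤n = *-cancelˡ-≤ 0<δ (begin
      δ * T
        ≤⟨ *-monoʳ-≤ 0<δ upper ⟩
      δ * (c₂ * V + W)
        ≈⟨ solve 4 (λ d k v w → d :* (k :* v :+ w) := k :* (d :* v) :+ d :* w) refl δ c₂ V W ⟩
      c₂ * (δ * V) + δ * W
        ≤⟨ +-mono-≤ (*-monoʳ-≤ 0<c₂ (volume-upper {n} {i} start≤n))
             (≤-trans (*-monoʳ-≤ 0<δ (fromℕ-mono-≤ (ℕₚ.≤-trans (ℕₚ.m≤m+n w _) 4w≤n))) (δn≤αn n)) ⟩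
      c₂ * (fromℕ 3 * Y) + Y
        ≈⟨ solve 3 (λ k m y → k :* (m :* y) :+ y := (m :* k :+ con 1) :* y) refl c₂ (fromℕ 3) Y ⟩
      (fromℕ 3 * c₂ + 1#) * Y
        ≈⟨ δ[kYδ⁻¹]≈kY _ ⟨
      δ * ((fromℕ 3 * c₂ + 1#) * (Y * δ⁻¹)) ∎)

    -- The quarter `q` consists of one factor 2 lost in `volume-lower` and another given up to
    -- absorb the slack.
    cost-lower : ∀ {q} → fromℕ 4 * q ≈ 1# → n ℕ.≤ p i → 2 ℕ.* (2 ℕ.+ i) ℕ.≤ n →
                 (c₁ * q) * (Y * δ⁻¹) ≤ T
    cost-lower {q} 4q≈1 n≤pᵢ 2[2+i]≤n =
      *-cancelˡ-≤ 0<δ (*-cancelˡ-≤ 0<4 (begin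
        fromℕ 4 * (δ * ((c₁ * q) * (Y * δ⁻¹)))  ≈⟨ *-congˡ (δ[kYδ⁻¹]≈kY _) ⟩
        fromℕ 4 * ((c₁ * q) * Y)
          ≈⟨ solve 4 (λ m q k y → m :* ((k :* q) :* y) := (m :* q) :* (k :* y)) refl (fromℕ 4) q c₁ Y ⟩
        (fromℕ 4 * q) * (c₁ * Y)                ≈⟨ *-congʳ 4q≈1 ⟩
        1# * (c₁ * Y)                           ≈⟨ *-identityˡ _ ⟩
        c₁ * Y                                  ≤⟨ c₁Y≤4δT ⟩
        fromℕ 4 * (δ * T)                       ∎))
      where
      c₁Y≤ : c₁ * Y ≤ c₁ * (fromℕ 2 * (δ * V))
      c₁Y≤ = *-monoʳ-≤ 0<c₁ (volume-lower {n} {i} n≤pᵢ 2[2+i]≤n)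
      two  = con 1 :+ (con 1 :+ con 0)
      four = con 1 :+ (con 1 :+ two)
      -- Doubling leaves a spare copy of `c₁ * Y`. The slack term, 4 c₁ δ w, is at most this copy
      -- because 4 w ≤ n.
      c₁Y≤4δT : c₁ * Y ≤ fromℕ 4 * (δ * T)
      c₁Y≤4δT = +-cancelʳ-≤ (c₁ * Y) (begin
        c₁ * Y + c₁ * Y
          ≤⟨ +-mono-≤ c₁Y≤ c₁Y≤ ⟩
        c₁ * (fromℕ 2 * (δ * V)) + c₁ * (fromℕ 2 * (δ * V))
          ≈⟨ solve 3 (λ k d v → k :* (two :* (d :* v)) :+ k :* (two :* (d :* v))
                     := four :* (d :* (k :* v))) refl c₁ δ V ⟩
        fromℕ 4 * (δ * (c₁ * V))
          ≤⟨ *-monoʳ-≤ 0<4 (*-monoʳ-≤ 0<δ lower) ⟩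
        fromℕ 4 * (δ * (T + c₁ * W))
          ≈⟨ solve 5 (λ m d t k w → m :* (d :* (t :+ k :* w)) := m :* (d :* t) :+ k :* (d :* (m :* w)))
               refl (fromℕ 4) δ T c₁ W ⟩
        fromℕ 4 * (δ * T) + c₁ * (δ * (fromℕ 4 * W))
          ≈⟨ +-congˡ (*-congˡ (*-congˡ (fromℕ-* 4 w))) ⟨
        fromℕ 4 * (δ * T) + c₁ * (δ * fromℕ (4 ℕ.* w))
          ≤⟨ +-monoʳ-≤ _ (*-monoʳ-≤ 0<c₁ (≤-trans (*-monoʳ-≤ 0<δ (fromℕ-mono-≤ 4w≤n)) (δn≤αn n))) ⟩
        fromℕ 4 * (δ * T) + c₁ * Y ∎)

  -- Turns the eventual bound into one for all sizes: below the threshold `N` the finite worst-case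
  -- cost at each size is booked as slack, and from `N` on the slack is 0. Only finitely many sizes
  -- are charged, hence the uniform total `K`.
  linearTime⇒slack : ∀ {a r} {A : Set a} {_≺_ : Rel A r}
    (≺-sto : IsStrictTotalOrder _≡_ _≺_) (select : Selector ≺-sto) →
    ∀ {c₁ c₂} (0<c₁ : 0# < c₁) → 0# < c₂ →
    EventuallyBetween R (inputSize ≺-sto) (selectionCost ≺-sto select) c₁ c₂ fromℕ →
    (∀ m → ∃[ B ] ∀ x → inputSize ≺-sto x ≡ m → selectionCost ≺-sto select x ℕ.≤ B) →
    ∃[ slack ] ∃[ K ] (∀ m → ∑< slack m ℕ.≤ K) ×
      (∀ x → let m = inputSize ≺-sto x in
        Cost.Within {c₁} {c₂} 0<c₁ (selectionCost ≺-sto select x) m (slack m))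
  linearTime⇒slack ≺-sto select {c₁} {c₂} 0<c₁ 0<c₂ (N , large) small =
    slack , ∑< slack N , ∑<-bounded slack N (truncate-≥ N bound) , selection
    where
    open Cost {c₁} {c₂} 0<c₁

    bound slack : ℕ → ℕ
    -- The summand `m` makes the lower bound trivial, and the worst-case cost makes the upper bound
    -- trivial.
    bound m = m ℕ.+ proj₁ (small m)
    slack = truncate N bound

    selection : ∀ x → let m = inputSize ≺-sto x in Within (selectionCost ≺-sto select x) m (slack m)
    selection x with N ℕₚ.≤? inputSize ≺-sto x
    ... | yes N≤m = within-mono z≤n (within
      (≤-trans (proj₂ (large x N≤m)) (≤-reflexive (sym (+-identityʳ _))))
      (≤-trans (proj₁ (large x N≤m))
        (≤-reflexive (sym (trans (+-congˡ (zeroʳ c₁)) (+-identityʳ _))))))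
    ... | no  N≰m rewrite truncate-< N bound (inputSize ≺-sto x) (ℕₚ.≰⇒> N≰m) = within
      (begin
        fromℕ t               ≤⟨ fromℕ-mono-≤ (ℕₚ.≤-trans (proj₂ (small m) x ≡.refl) (ℕₚ.m≤n+m _ m)) ⟩
        fromℕ (bound m)       ≈⟨ +-identityˡ _ ⟨
        0# + fromℕ (bound m)  ≤⟨ +-monoˡ-≤ _ (*-nonneg 0<c₂ (0≤fromℕ m)) ⟩
        c₂ * fromℕ m + fromℕ (bound m) ∎)
      (begin
        c₁ * fromℕ m                 ≤⟨ *-monoʳ-≤ 0<c₁ (fromℕ-mono-≤ (ℕₚ.m≤m+n m _)) ⟩
        c₁ * fromℕ (bound m)         ≈⟨ +-identityˡ _ ⟨
        0# + c₁ * fromℕ (bound m)    ≤⟨ +-monoˡ-≤ _ (0≤fromℕ t) ⟩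
        fromℕ t + c₁ * fromℕ (bound m) ∎)
      where
      m = inputSize ≺-sto x
      t = selectionCost ≺-sto select x

  -- The constants c₁ / 4 and 3 c₂ + 1 are fixed before α and the pivots are given; only the
  -- threshold depends on these, through `J`.
  lohify-Θ : ∀ {a r} {A : Set a} {_≺_ : Rel A r} (≺-sto : IsStrictTotalOrder _≡_ _≺_)
    (select : Selector ≺-sto) → LinearTime ≺-sto R select →
    ∃[ c₁ ] ∃[ c₂ ] 0# < c₁ × 0# < c₂ ×
    (∀ (α : Carrier) (1<α : 1# < α) (p : ℕ → ℕ) → IsPivots R α p →
    EventuallyBetween R Array.size (runtime ≺-sto select p)
    c₁ c₂ (λ n → α * fromℕ n /⟨ α - 1# ⟩ 1<α))
  lohify-Θ ≺-sto select ((c₁ , c₂ , 0<c₁ , 0<c₂ , large) , small)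
    with linearTime⇒slack ≺-sto select 0<c₁ 0<c₂ large small | recip 0<4
  ... | slack , K , slack≤K , selection | q , 4q≈1 =
    c₁ * q , fromℕ 3 * c₂ + 1# , *-pos 0<c₁ (inverse-pos 0<4 4q≈1) , 0<3c₂+1 , eventually
    where
    0<3c₂+1 : 0# < fromℕ 3 * c₂ + 1#
    0<3c₂+1 = begin-strict
      0#                 <⟨ 0<1 ⟩
      1#                 ≈⟨ +-identityˡ 1# ⟨
      0# + 1#            <⟨ +-monoˡ-< 1# (*-pos (fromℕ-mono-< {0} {3} (s≤s z≤n)) 0<c₂) ⟩
      fromℕ 3 * c₂ + 1#  ∎

    eventually : ∀ α (1<α : 1# < α) p → IsPivots R α p →
      EventuallyBetween R Array.size (runtime ≺-sto select p)
        (c₁ * q) (fromℕ 3 * c₂ + 1#) (λ n → α * fromℕ n /⟨ α - 1# ⟩ 1<α)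
    eventually α 1<α p isPivots = threshold , bounds
      where
      α≈δ+1 : α ≈ (α - 1#) + 1#
      α≈δ+1 = sym (RingProperties.//-rightDividesˡ ring 1# α)
      0<δ = x<y⇒0<y-x 1<α
      open Pivots α≈δ+1 0<δ {p} isPivots

      J threshold : ℕ
      J = proj₁ geometric-superlinear
      -- The part 8 + 4J secures i + 2 ≤ n / 2, and the part 4K keeps four times the slack below n.
      threshold = 8 ℕ.+ 4 ℕ.* J ℕ.+ 4 ℕ.* K

      bounds : ∀ xs → threshold ℕ.≤ Array.size xs → _
      bounds xs N≤n
        with selectAway-within ≺-sto select p start-increasing slack selection n xs
               (ℕₚ.≤-trans (s≤s z≤n) N≤n) (i≤start n)
        where
        n = Array.size xs
        open Cost {c₁} {c₂} 0<c₁
      ... | i , start<n , n≤pᵢ , withinBounds =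
        cost-lower 4q≈1 n≤pᵢ (2[2+i]≤n {j = J} 4i≤n+4J (ℕₚ.m+n≤o⇒m≤o _ N≤n)) ,
        cost-upper (ℕₚ.<⇒≤ start<n)
        where
        4i≤n+4J = ℕₚ.≤-trans (proj₂ geometric-superlinear i)
          (ℕₚ.+-monoˡ-≤ (4 ℕ.* J) (ℕₚ.<⇒≤ start<n))
        4w≤n = ℕₚ.≤-trans (ℕₚ.*-monoʳ-≤ 4 (slack≤K (suc (Array.size xs)))) (ℕₚ.m+n≤o⇒n≤o (8 ℕ.+ 4 ℕ.* J) N≤n)
        -- The right-inverse law is taken for the very inverse of α - 1 that `_/⟨_-_⟩_` uses, so the
        -- bounds have the required form as they stand.
        open Conclusion α≈δ+1 0<δ (proj₂ (proj₂ (#⇒invertible (>⇒# 1<α)))) {p} isPivots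
          0<c₁ 0<c₂ (Array.size xs) i withinBounds 4w≤n

theorem2p4 : ∀ {c ℓ₁ ℓ₂ ℓ₃ a r}
    (R : ArchimedeanOrderedField c ℓ₁ ℓ₂ ℓ₃)
    {A : Set a} {_≺_ : Rel A r} (≺-sto : IsStrictTotalOrder _≡_ _≺_)
    (select : Selector ≺-sto) →
    LinearTime ≺-sto R select →
    let open ArchimedeanOrderedField R in
    ∃[ c₁ ] ∃[ c₂ ] 0# < c₁ × 0# < c₂ ×
    (∀ (α : Carrier) (1<α : 1# < α) (p : ℕ → ℕ) → IsPivots R α p →
    EventuallyBetween R Array.size (runtime ≺-sto select p)
    c₁ c₂ (λ n → α * fromℕ n /⟨ α - 1# ⟩ 1<α))
theorem2p4 R = Analysis.lohify-Θ R
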